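{- For any integers $k \ge 3$ and $C \ge 0$, there exists a constant $N = N(k,C)$ such that for all $n \ge N$, every $k$-uniform hypergraph on $n$ vertices has at most $n - C$ different clique sizes; that is, the set $\{|S| : S \text{ is a clique of } \mathcal{H}\}$ has at most $n-C$ elements for every $n$-vertex $k$-uniform hypergraph $\mathcal{H}$.
   Context: Let $k \ge 2$ and let $\mathcal{H}$ be a $k$-uniform hypergraph. A vertex set $S$ of $\mathcal{H}$ forms a complete graph if every $k$-element subset of $S$ is an edge of $\mathcal{H}$. A clique of $\mathcal{H}$ is a vertex set forming a complete graph that is maximal with respect to inclusion, i.e. not contained in any strictly larger vertex set forming a complete graph. -}

module Defs where


open import Data.Nat using (ℕ)
open import Data.Fin.Subset using (Subset; _⊆_; ∣_∣)
open import Data.List using (List; length)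
open import Data.List.Membership.Propositional using (_∈_)
open import Data.List.Relation.Unary.Unique.Propositional using (Unique)
open import Relation.Binary.PropositionalEquality using (_≡_)

record Hypergraph (n : ℕ) : Set₁ where
  field
    Edge : Subset n → Set

open Hypergraph public

IsUniform : ∀ {n} → ℕ → Hypergraph n → Set
IsUniform k H = ∀ e → Edge H e → ∣ e ∣ ≡ k

FormsComplete : ∀ {n} → ℕ → Hypergraph n → Subset n → Set
FormsComplete k H S = ∀ e → e ⊆ S → ∣ e ∣ ≡ k → Edge H e

IsClique : ∀ {n} → ℕ → Hypergraph n → Subset n → Set
IsClique k H S = FormsComplete k H S × (∀ T → S ⊆ T → FormsComplete k H T → T ≡ S)
  where open import Data.Product using (_×_)

IsCliqueSize : ∀ {n} → ℕ → Hypergraph n → ℕ → Set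
IsCliqueSize k H m = Σ (Subset _) (λ S → IsClique k H S × ∣ S ∣ ≡ m)
  where open import Data.Product using (Σ; _×_)

AtMostCliqueSizes : ∀ {n} → ℕ → Hypergraph n → ℕ → Set
AtMostCliqueSizes k H b =
  ∀ (xs : List ℕ) → Unique xs → (∀ {m} → m ∈ xs → IsCliqueSize k H m) → length xs Data.Nat.≤ b
  where import Data.Nat

{-# OPTIONS --safe #-}
-- Fix a cell (B, X), a partial assignment: only cliques S with S ∩ B = X are considered.
-- A non-edge e can constrain such an S only if e ∩ B ⊆ X, and then only through e ─ B;
-- the rank of the cell bounds the size of these residual edges. Rank 0 determines S.
-- If some clique S of the cell has a small complement, then ∁ S ─ B meets every residual
-- edge, so deciding the elements of ∁ S ─ B splits the cell into boundedly many cells of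
-- smaller rank. Otherwise the cell contributes no clique size close to n at all.
-- By induction on the rank, boundedly many cells cannot realise all but C of the numbers
-- d < N as sizes of complements of cliques, for N depending only on the rank, the number
-- of cells and C. This is applied to the single cell (⊥, ⊥), of rank k.
module Submission where

open import Defs
open import Data.Fin.Subset
  using (Subset; Nonempty; inside; outside; _∩_; _∪_; _─_; ∁; ⊥; ∣_∣; _⊆_)
  renaming (_∈_ to _∈ˢ_; _∉_ to _∉ˢ_)
open import Data.Fin.Subset.Properties
  using (_∈?_; nonempty?; out⊆; s⊆s; ∣p∣≤n; ∣∁p∣≡n∸∣p∣; ∣p─q∣≤∣p∣; p─q─r≡p─q∪r;
         p∩q≢∅⇒∣p─q∣<∣p∣; x∈p∧x∉q⇒x∈p─q; x∈∁p⇒x∉p; x∉p⇒x∈∁p; x∈p∩q⁺; x∈p∩q⁻;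
         x∈p∪q⁺; x∈p∪q⁻; ∩-distribˡ-∪; ∩-zeroʳ)
open import Data.List using (List; []; _∷_; [_]; _++_; map; filter; length; upTo)
open import Data.List.Membership.Propositional using (_∈_; _∉_; find; lose)
open import Data.List.Membership.Propositional.Properties
  using (∈-∃++; ∈-++⁺ˡ; ∈-++⁺ʳ; ∈-++⁻; ∈-map⁺; ∈-upTo⁺; ∈-upTo⁻; ∈-filter⁺; ∈-filter⁻)
open import Data.List.Properties using (length-++; length-map; length-++-sucʳ; length-upTo)
open import Data.List.Relation.Unary.All using (All; []; _∷_)
import Data.List.Relation.Unary.All as All
import Data.List.Relation.Unary.All.Properties as All
open import Data.List.Relation.Unary.AllPairs using ([]; _∷_)
open import Data.List.Relation.Unary.Any using (Any; here; there)
import Data.List.Relation.Unary.Any as Any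
import Data.List.Relation.Unary.Any.Properties as Any
open import Data.List.Relation.Unary.Unique.Propositional using (Unique)
import Data.List.Relation.Unary.Unique.Propositional.Properties as Unique
open import Data.Nat
  using (ℕ; zero; suc; _+_; _∸_; _^_; _≤_; _<_; _≥_; _⊔_; z≤n; s≤s; s≤s⁻¹)
open import Data.Nat.Properties
open import Data.List.Membership.DecPropositional _≟_ using () renaming (_∈?_ to _∈ᴸ?_)
open import Data.Product using (Σ; ∃; _×_; _,_; proj₁; proj₂)
open import Data.Sum using (_⊎_; inj₁; inj₂)
open import Data.Vec using ([]; _∷_; here; there)
open import Function using (_∘_; case_of_)
open import Relation.Binary.PropositionalEquality
  using (_≡_; _≢_; refl; sym; trans; cong; cong₂; subst)
open import Relation.Nullary using (¬_; Dec; yes; no; ¬?; contradiction)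
open import Relation.Nullary.Decidable using (decidable-stable; ¬¬-excluded-middle)

private
  variable
    n : ℕ

-- Preliminaries on lists without repetition and on finite subsets.

Unique-⊆⇒length≤ : ∀ {a} {A : Set a} {xs ys : List A} →
  Unique xs → (∀ {x} → x ∈ xs → x ∈ ys) → length xs ≤ length ys
Unique-⊆⇒length≤ [] xs⊆ys = z≤n
Unique-⊆⇒length≤ {xs = x ∷ xs} (x∉xs ∷ xs!) xs⊆ys with ∈-∃++ (xs⊆ys (here refl))
-- One occurrence of `x` is cut out of `ys`; the tail `xs` avoids `x`, so it still fits into
-- `ls ++ rs`.
... | ls , rs , refl = ≤-trans (s≤s (Unique-⊆⇒length≤ xs! xs⊆ls++rs))
                               (≤-reflexive (sym (length-++-sucʳ ls x rs)))
  where
  xs⊆ls++rs : ∀ {y} → y ∈ xs → y ∈ ls ++ rs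
  xs⊆ls++rs y∈xs with ∈-++⁻ ls (xs⊆ys (there y∈xs))
  ... | inj₁ y∈ls         = ∈-++⁺ˡ y∈ls
  ... | inj₂ (here refl)  = contradiction refl (All.lookup x∉xs y∈xs)
  ... | inj₂ (there y∈rs) = ∈-++⁺ʳ ls y∈rs

absent? : ∀ xs (m : ℕ) → Dec (m ∉ xs)
absent? xs m = ¬? (m ∈ᴸ? xs)

absent : ℕ → List ℕ → List ℕ
absent n xs = filter (absent? xs) (upTo n)

length+absent≤ : ∀ {n xs} → Unique xs → (∀ {m} → m ∈ xs → m < n) →
  length xs + length (absent n xs) ≤ n
length+absent≤ {n} {xs} xs! xs<n = begin
  length xs + length (absent n xs) ≡⟨ length-++ xs ⟨
  length (xs ++ absent n xs)       ≤⟨ Unique-⊆⇒length≤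
    (Unique.++⁺ xs! (Unique.filter⁺ (absent? xs) (Unique.upTo⁺ n))
      λ (m∈xs , m∈absent) → proj₂ (∈-filter⁻ (absent? xs) {xs = upTo n} m∈absent) m∈xs)
    xs++absent⊆upTo ⟩
  length (upTo n)                  ≡⟨ length-upTo n ⟩
  n                                ∎
  where
  open ≤-Reasoning

  xs++absent⊆upTo : ∀ {m} → m ∈ xs ++ absent n xs → m ∈ upTo n
  xs++absent⊆upTo m∈ with ∈-++⁻ xs m∈
  ... | inj₁ m∈xs     = ∈-upTo⁺ (xs<n m∈xs)
  ... | inj₂ m∈absent = proj₁ (∈-filter⁻ (absent? xs) m∈absent)

-- Edges are an arbitrary predicate, so deciding them is possible only under double negation. The
-- double negation passes through the quantifier because there are finitely many subsets, split here
-- by their first coordinate.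
¬¬-decidable : {P : Subset n → Set} → ¬ ¬ (∀ e → Dec (P e))
¬¬-decidable {zero} k = ¬¬-excluded-middle λ p? → k λ { [] → p? }
¬¬-decidable {suc n} k = ¬¬-decidable λ out? → ¬¬-decidable λ in? →
  k λ { (outside ∷ e) → out? e ; (inside ∷ e) → in? e }

x∈p─q⇒x∉q : ∀ (p q : Subset n) {x} → x ∈ˢ p ─ q → x ∉ˢ q
x∈p─q⇒x∉q (_ ∷ p) (_ ∷ q) (there x∈p─q) (there x∈q) = x∈p─q⇒x∉q p q x∈p─q x∈q

subsets : Subset n → List (Subset n)
subsets []            = [ [] ]
subsets (outside ∷ p) = map (outside ∷_) (subsets p)
subsets (inside  ∷ p) = map (outside ∷_) (subsets p) ++ map (inside ∷_) (subsets p)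

length-subsets : (p : Subset n) → length (subsets p) ≡ 2 ^ ∣ p ∣
length-subsets []            = refl
length-subsets (outside ∷ p) = trans (length-map _ (subsets p)) (length-subsets p)
length-subsets (inside  ∷ p) = trans (length-++ (map (outside ∷_) (subsets p)))
  (cong₂ _+_ (trans (length-map _ (subsets p)) (length-subsets p))
             (trans (trans (length-map _ (subsets p)) (length-subsets p)) (sym (+-identityʳ _))))

∩∈subsets : (q p : Subset n) → q ∩ p ∈ subsets p
∩∈subsets []            []            = here refl
∩∈subsets (outside ∷ q) (outside ∷ p) = ∈-map⁺ _ (∩∈subsets q p)
∩∈subsets (inside  ∷ q) (outside ∷ p) = ∈-map⁺ _ (∩∈subsets q p)
∩∈subsets (outside ∷ q) (inside  ∷ p) = ∈-++⁺ˡ (∈-map⁺ _ (∩∈subsets q p))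
∩∈subsets (inside  ∷ q) (inside  ∷ p) = ∈-++⁺ʳ _ (∈-map⁺ _ (∩∈subsets q p))

subsets-⊆ : (p : Subset n) → All (_⊆ p) (subsets p)
subsets-⊆ []            = (λ x∈p → x∈p) ∷ []
subsets-⊆ (outside ∷ p) = All.map⁺ (All.map out⊆ (subsets-⊆ p))
subsets-⊆ (inside  ∷ p) = All.++⁺ (All.map⁺ (All.map out⊆ (subsets-⊆ p)))
                                  (All.map⁺ (All.map s⊆s (subsets-⊆ p)))

-- Cells and their refinement.

Cell : ℕ → Set
Cell n = Subset n × Subset n

Matches : Subset n → Cell n → Set
Matches S (B , X) = S ∩ B ≡ X

refine : Cell n → Subset n → List (Cell n)
refine (B , X) T = map (λ Y → B ∪ T , X ∪ Y) (subsets T)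

length-refine : (c : Cell n) (T : Subset n) → length (refine c T) ≡ 2 ^ ∣ T ∣
length-refine c T = trans (length-map _ (subsets T)) (length-subsets T)

-- The children are indexed by the possible traces on `T`, and `S ∩ T` is one of them.
Matches-refine : ∀ {S} (c : Cell n) T → Matches S c → Any (Matches S) (refine c T)
Matches-refine {S = S} (B , X) T S∩B≡X = Any.map⁺ (lose (∩∈subsets S T)
  (trans (∩-distribˡ-∪ S B T) (cong (_∪ (S ∩ T)) S∩B≡X)))

-- Cliques inside a cell and the rank of a cell.

module _ (k : ℕ) where

  module _ (H : Hypergraph n) where

    Rank≤ : ℕ → Cell n → Set
    Rank≤ r (B , X) = ∀ e → ∣ e ∣ ≡ k → ¬ Edge H e → e ∩ B ⊆ X → ∣ e ─ B ∣ ≤ r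

    CliqueIn : Cell n → Subset n → Set
    CliqueIn c S = IsClique k H S × Matches S c

    -- Sizes are measured by complements, so that the large cliques are those with small `d` and
    -- thresholds on `d` can be chosen independently of `n`.
    Realises : List (Cell n) → ℕ → Set
    Realises cs d = Σ (Subset n) λ S → ∣ ∁ S ∣ ≡ d × Any (λ c → CliqueIn c S) cs

    module _ (edge? : ∀ e → Dec (Edge H e)) where

      -- `X ∪ ∁ B` is the largest set with trace `X` on `B`, so it contains `S`. A non-edge inside
      -- it would have no vertex outside `B` by the rank bound, hence would lie in `X` and so in the
      -- complete set `S`. It is therefore complete, and maximality of `S` gives equality.
      Rank0⇒clique≡ : ∀ {B X S} → Rank≤ 0 (B , X) → CliqueIn (B , X) S → X ∪ ∁ B ≡ S
      Rank0⇒clique≡ {B} {X} {S} rank ((complete , maximal) , S∩B≡X) =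
        maximal (X ∪ ∁ B) S⊆U U-complete
        where
        S⊆U : S ⊆ X ∪ ∁ B
        S⊆U {v} v∈S with v ∈? B
        ... | yes v∈B = x∈p∪q⁺ (inj₁ (subst (v ∈ˢ_) S∩B≡X (x∈p∩q⁺ (v∈S , v∈B))))
        ... | no  v∉B = x∈p∪q⁺ (inj₂ (x∉p⇒x∈∁p v∉B))

        X⊆S : X ⊆ S
        X⊆S v∈X = proj₁ (x∈p∩q⁻ S B (subst (_ ∈ˢ_) (sym S∩B≡X) v∈X))

        U-complete : FormsComplete k H (X ∪ ∁ B)
        U-complete e e⊆U ∣e∣≡k with edge? e
        ... | yes edge  = edge
        ... | no ¬edge = complete e e⊆S ∣e∣≡k
          where
          e∩B⊆X : e ∩ B ⊆ X
          e∩B⊆X v∈e∩B with x∈p∩q⁻ e B v∈e∩B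
          ... | v∈e , v∈B with x∈p∪q⁻ X (∁ B) (e⊆U v∈e)
          ...   | inj₁ v∈X  = v∈X
          ...   | inj₂ v∈∁B = contradiction v∈B (x∈∁p⇒x∉p v∈∁B)

          e⊆S : e ⊆ S
          e⊆S {v} v∈e with v ∈? B
          ... | yes v∈B = X⊆S (e∩B⊆X (x∈p∩q⁺ (v∈e , v∈B)))
          ... | no  v∉B = contradiction (rank e ∣e∣≡k ¬edge e∩B⊆X)
                            -- Removing `e ─ B` from itself strictly lowers its size, which is thus
                            -- positive.
                            (<⇒≱ (≤-<-trans z≤n (p∩q≢∅⇒∣p─q∣<∣p∣ (e ─ B) (e ─ B)
                              (v , x∈p∩q⁺ (v∈e─B , v∈e─B)))))
            where v∈e─B = x∈p∧x∉q⇒x∈p─q v∈e v∉B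

      -- A non-edge constraining a child also constrains the parent, since `Y` is disjoint from `B`.
      -- Its residue `e ─ B` must meet `T`, as otherwise `e` would lie in the complete set `S`;
      -- deciding `T` thus removes at least one vertex from the residue.
      Rank≤-refine : ∀ {r B X S} → Rank≤ (suc r) (B , X) → CliqueIn (B , X) S →
        All (Rank≤ r) (refine (B , X) (∁ S ─ B))
      Rank≤-refine {r} {B} {X} {S} rank ((complete , _) , S∩B≡X) =
        All.map⁺ (All.map child (subsets-⊆ T))
        where
        T = ∁ S ─ B

        child : ∀ {Y} → Y ⊆ T → Rank≤ r (B ∪ T , X ∪ Y)
        child {Y} Y⊆T e ∣e∣≡k ¬edge e∩B∪T⊆X∪Y =
          s≤s⁻¹ (≤-trans (subst (λ p → ∣ p ∣ < ∣ e ─ B ∣) (p─q─r≡p─q∪r e B T)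
                                (p∩q≢∅⇒∣p─q∣<∣p∣ (e ─ B) T meets))
                         (rank e ∣e∣≡k ¬edge e∩B⊆X))
          where
          e∩B⊆X : e ∩ B ⊆ X
          e∩B⊆X v∈e∩B with x∈p∩q⁻ e B v∈e∩B
          ... | v∈e , v∈B with x∈p∪q⁻ X Y (e∩B∪T⊆X∪Y (x∈p∩q⁺ (v∈e , x∈p∪q⁺ (inj₁ v∈B))))
          ...   | inj₁ v∈X = v∈X
          ...   | inj₂ v∈Y = contradiction v∈B (x∈p─q⇒x∉q (∁ S) B (Y⊆T v∈Y))

          meets : Nonempty ((e ─ B) ∩ T)
          meets with nonempty? ((e ─ B) ∩ T)
          ... | yes ne = ne
          ... | no  ∅  = contradiction (complete e e⊆S ∣e∣≡k) ¬edge
            where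
            e⊆S : e ⊆ S
            e⊆S {v} v∈e with v ∈? B | v ∈? S
            ... | _       | yes v∈S = v∈S
            ... | yes v∈B | no  _   = proj₁ (x∈p∩q⁻ S B
              (subst (v ∈ˢ_) (sym S∩B≡X) (e∩B⊆X (x∈p∩q⁺ (v∈e , v∈B)))))
            ... | no  v∉B | no  v∉S = contradiction
              (v , x∈p∩q⁺ (x∈p∧x∉q⇒x∈p─q v∈e v∉B , x∈p∧x∉q⇒x∈p─q (x∉p⇒x∈∁p v∉S) v∉B)) ∅

  -- Induction on the rank.

  RealisesAllBut : List ℕ → ℕ → (H : Hypergraph n) → List (Cell n) → Set
  RealisesAllBut ds N H cs = ∀ d → d < N → d ∉ ds → Realises H cs d

  -- The exempt values `ds` are carried along because a rank 0 cell is disposed of by exempting the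
  -- only value it can realise.
  Missing : (r m C N : ℕ) → Set₁
  Missing r m C N = ∀ {n} (H : Hypergraph n) → (∀ e → Dec (Edge H e)) →
    ∀ cs → All (Rank≤ H r) cs → length cs ≤ m →
    ∀ ds → length ds ≤ C → ¬ RealisesAllBut ds N H cs

  -- An intermediate stage in passing from rank `r` to `suc r`: the cells `as` still await
  -- refinement, while `bs` already have the smaller rank.
  MissingMixed : (r p m C N : ℕ) → Set₁
  MissingMixed r p m C N = ∀ {n} (H : Hypergraph n) → (∀ e → Dec (Edge H e)) →
    ∀ as bs → All (Rank≤ H (suc r)) as → All (Rank≤ H r) bs → length as ≤ p → length bs ≤ m →
    ∀ ds → length ds ≤ C → ¬ RealisesAllBut ds N H (as ++ bs)

  -- All cliques in a rank 0 cell coincide, so dropping the cell costs at most one further exempt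
  -- value. Once no cells remain, `suc C` values cannot all be among `C` exempt ones. The witness
  -- unfolds to `m + C + 1`.
  missing-rank0 : ∀ m C → ∃ (Missing 0 m C)
  missing-rank0 zero C = suc C , λ { H edge? [] [] _ ds ∣ds∣≤C realises → <⇒≱ (s≤s ∣ds∣≤C)
      (subst (_≤ length ds) (length-upTo (suc C))
        (Unique-⊆⇒length≤ (Unique.upTo⁺ (suc C)) λ {d} d∈upTo →
          decidable-stable (d ∈ᴸ? ds) λ d∉ds →
            case realises d (∈-upTo⁻ d∈upTo) d∉ds of λ { (_ , _ , ()) })) }
  missing-rank0 (suc m) C with missing-rank0 m (suc C)
  ... | N , missing = N , go
    where
    go : Missing 0 (suc m) C N
    go H edge? [] [] _ ds ∣ds∣≤C = missing H edge? [] [] z≤n ds (m≤n⇒m≤1+n ∣ds∣≤C)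
    go {n} H edge? (c ∷ cs) (rank ∷ ranks) ∣cs∣≤m ds ∣ds∣≤C realises =
      -- The goal is a contradiction, so whether the cell contains a clique may be decided
      -- classically.
      ¬¬-excluded-middle {A = Σ (Subset n) (CliqueIn H c)} λ where
        (yes (S , cliqueS)) → missing H edge? cs ranks (s≤s⁻¹ ∣cs∣≤m) (∣ ∁ S ∣ ∷ ds) (s≤s ∣ds∣≤C)
          λ d d<N d∉ → drop cliqueS (d∉ ∘ here ∘ sym) (realises d d<N (d∉ ∘ there))
        (no ∄S) → missing H edge? cs ranks (s≤s⁻¹ ∣cs∣≤m) ds (m≤n⇒m≤1+n ∣ds∣≤C)
          λ d d<N d∉ → case realises d d<N d∉ of λ where
            (S , _  , here cliqueS) → contradiction (S , cliqueS) ∄S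
            (S , ≡d , there any)    → S , ≡d , any
      where
      drop : ∀ {d S} → CliqueIn H c S → ∣ ∁ S ∣ ≢ d → Realises H (c ∷ cs) d → Realises H cs d
      drop _       _  (S′ , ≡d , there any)     = S′ , ≡d , any
      drop cliqueS ≢d (S′ , ≡d , here cliqueS′) = contradiction
        (trans (cong (∣_∣ ∘ ∁) (trans (sym (Rank0⇒clique≡ H edge? rank cliqueS))
                                      (Rank0⇒clique≡ H edge? rank cliqueS′))) ≡d) ≢d

  -- Induction on `p`, with `t` the threshold below which `bs` alone must fail. If no cell of `as`
  -- has a clique with complement smaller than `t`, then `bs` would have to realise everything below
  -- `t`. Otherwise such a cell is refined and its children move to `bs`.
  missing-mixed : ∀ {r} → (∀ m C → ∃ (Missing r m C)) → ∀ p m C → ∃ (MissingMixed r p m C)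
  missing-mixed IH zero m C with IH m C
  ... | N , missing = N , λ { H edge? [] bs _ ranks _ ∣bs∣≤m → missing H edge? bs ranks ∣bs∣≤m }
  missing-mixed {r} IH (suc p) m C with IH m C
  -- A clique that triggers a refinement has complement smaller than `t`, so at most `2 ^ t`
  -- children join the `m` cells of rank `r`.
  ... | t , missing with missing-mixed IH p (2 ^ t + m) C
  ...   | N , mixed = t ⊔ N , go
    where
    go : MissingMixed r (suc p) m C (t ⊔ N)
    go {n} H edge? as bs ranksA ranksB ∣as∣≤1+p ∣bs∣≤m ds ∣ds∣≤C realises =
      ¬¬-excluded-middle {A = Any HasSmall as} λ where
        (yes small) → split (find small)
        (no ¬small) → missing H edge? bs ranksB ∣bs∣≤m ds ∣ds∣≤C λ d d<t d∉ds →
          dropA ¬small d<t (realises d (m<n⇒m<n⊔o N d<t) d∉ds)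
      where
      HasSmall : Cell n → Set
      HasSmall c = Σ (Subset n) λ S → ∣ ∁ S ∣ < t × CliqueIn H c S

      dropA : ∀ {d} → ¬ Any HasSmall as → d < t → Realises H (as ++ bs) d → Realises H bs d
      dropA ¬small d<t (S , refl , any) with Any.++⁻ as any
      ... | inj₁ anyA = contradiction (Any.map (λ clique → S , d<t , clique) anyA) ¬small
      ... | inj₂ anyB = S , refl , anyB

      split : ¬ ∃ (λ c → c ∈ as × HasSmall c)
      split (c@(B , X) , c∈as , S , ∣∁S∣<t , cliqueS) with ∈-∃++ c∈as
      ... | ls , rs , refl = mixed H edge? (ls ++ rs) (refine c T ++ bs)
              (All.++⁺ (All.++⁻ˡ ls ranksA) (All.tail (All.++⁻ʳ ls ranksA)))
              (All.++⁺ (Rank≤-refine H edge? (All.lookup ranksA c∈as) cliqueS) ranksB)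
              (s≤s⁻¹ (subst (_≤ suc p) (length-++-sucʳ ls c rs) ∣as∣≤1+p))
              ∣refine∣≤ ds ∣ds∣≤C
              λ d d<N d∉ds → replace (realises d (m<n⇒m<o⊔n t d<N) d∉ds)
        where
        T = ∁ S ─ B

        ∣refine∣≤ : length (refine c T ++ bs) ≤ 2 ^ t + m
        ∣refine∣≤ = begin
          length (refine c T ++ bs)       ≡⟨ length-++ (refine c T) ⟩
          length (refine c T) + length bs ≡⟨ cong (_+ length bs) (length-refine c T) ⟩
          2 ^ ∣ T ∣ + length bs           ≤⟨ +-mono-≤ (^-monoʳ-≤ 2 ∣T∣≤t) ∣bs∣≤m ⟩
          2 ^ t + m                       ∎
          where
          open ≤-Reasoning
          ∣T∣≤t = ≤-trans (∣p─q∣≤∣p∣ (∁ S) B) (<⇒≤ ∣∁S∣<t)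

        replace : ∀ {d} → Realises H ((ls ++ [ c ] ++ rs) ++ bs) d →
          Realises H ((ls ++ rs) ++ (refine c T ++ bs)) d
        replace (S′ , ≡d , any) = S′ , ≡d , shift (Any.++⁻ (ls ++ [ c ] ++ rs) any)
          where
          shift : Any (λ c → CliqueIn H c S′) (ls ++ [ c ] ++ rs) ⊎ Any (λ c → CliqueIn H c S′) bs →
            Any (λ c → CliqueIn H c S′) ((ls ++ rs) ++ (refine c T ++ bs))
          shift (inj₂ anyB) = Any.++⁺ʳ (ls ++ rs) (Any.++⁺ʳ (refine c T) anyB)
          shift (inj₁ anyA) with Any.++⁻ ls anyA
          ... | inj₁ anyL                      = Any.++⁺ˡ (Any.++⁺ˡ anyL)
          ... | inj₂ (there anyR)              = Any.++⁺ˡ (Any.++⁺ʳ ls anyR)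
          ... | inj₂ (here (clique , matches)) = Any.++⁺ʳ (ls ++ rs)
                  (Any.++⁺ˡ (Any.map (clique ,_) (Matches-refine c T matches)))

  missing : ∀ r m C → ∃ (Missing r m C)
  missing zero    m C = missing-rank0 m C
  -- At the start every cell awaits refinement, hence the `0` for the cells of smaller rank.
  missing (suc r) m C with missing-mixed (missing r) m 0 C
  ... | N , mixed = N , λ H edge? cs ranks ∣cs∣≤m ds ∣ds∣≤C realises →
    mixed H edge? cs [] ranks [] ∣cs∣≤m z≤n ds ∣ds∣≤C
      λ d d<N d∉ds → let S , ≡d , any = realises d d<N d∉ds in S , ≡d , Any.++⁺ˡ any

-- From complements back to clique sizes.

theorem1p1 : (k C : ℕ) → k ≥ 3 →
    ∃ λ N → ∀ n → n ≥ N → (H : Hypergraph n) → IsUniform k H →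
    AtMostCliqueSizes k H (n ∸ C)
theorem1p1 k C _ with missing k k 1 C
... | N , missingₖ = N , go
  where
  go : ∀ n → n ≥ N → (H : Hypergraph n) → IsUniform k H → AtMostCliqueSizes k H (n ∸ C)
  go n n≥N H _ xs xs! sizes =
    -- The bound is a decidable statement, so it may be proved by contradiction, with edges taken to
    -- be decidable. The exempt values are the complements of the sizes not listed in `xs`.
    decidable-stable (length xs ≤? n ∸ C) λ ∣xs∣≰n∸C → ¬¬-decidable λ edge? →
      missingₖ H edge? [ (⊥ , ⊥) ] (rank≤k ∷ []) ≤-refl
        (map (n ∸_) (absent (suc n) xs)) (∣ds∣≤C ∣xs∣≰n∸C) realises
    where
    rank≤k : Rank≤ k H k (⊥ , ⊥)
    rank≤k e ∣e∣≡k _ _ = subst (∣ e ─ ⊥ ∣ ≤_) ∣e∣≡k (∣p─q∣≤∣p∣ e ⊥)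

    xs<1+n : ∀ {s} → s ∈ xs → s < suc n
    xs<1+n s∈xs with sizes s∈xs
    ... | S , _ , refl = s≤s (∣p∣≤n S)

    -- There are `suc n` candidate sizes, since 0 and `n` both count; the strict inequality
    -- `n ∸ C < length xs` makes up for the extra one.
    ∣ds∣≤C : ¬ length xs ≤ n ∸ C → length (map (n ∸_) (absent (suc n) xs)) ≤ C
    ∣ds∣≤C ∣xs∣≰n∸C = +-cancelˡ-≤ (length xs) _ _ (begin
      length xs + length (map (n ∸_) (absent (suc n) xs))
        ≡⟨ cong (length xs +_) (length-map (n ∸_) (absent (suc n) xs)) ⟩
      length xs + length (absent (suc n) xs) ≤⟨ length+absent≤ xs! xs<1+n ⟩
      suc n                                  ≤⟨ s≤s (m≤n+m∸n n C) ⟩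
      suc (C + (n ∸ C))                      ≤⟨ +-monoʳ-< C (≰⇒> ∣xs∣≰n∸C) ⟩
      C + length xs                          ≡⟨ +-comm C (length xs) ⟩
      length xs + C                          ∎)
      where open ≤-Reasoning

    realises : RealisesAllBut k (map (n ∸_) (absent (suc n) xs)) N H [ (⊥ , ⊥) ]
    -- Here `n ≥ N` matters: it gives `d ≤ n`, so that `n ∸ (n ∸ d)` is `d` even with truncated
    -- subtraction.
    realises d d<N d∉ds with sizes (decidable-stable (n ∸ d ∈ᴸ? xs) λ n∸d∉xs →
        d∉ds (subst (_∈ map (n ∸_) (absent (suc n) xs)) (m∸[m∸n]≡n d≤n)
          (∈-map⁺ (n ∸_) (∈-filter⁺ (absent? xs) (∈-upTo⁺ (s≤s (m∸n≤m n d))) n∸d∉xs))))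
      where d≤n = ≤-trans (<⇒≤ d<N) n≥N
    ... | S , clique , ∣S∣≡n∸d =
      S , trans (∣∁p∣≡n∸∣p∣ S) (trans (cong (n ∸_) ∣S∣≡n∸d) (m∸[m∸n]≡n (≤-trans (<⇒≤ d<N) n≥N)))
        , here (clique , ∩-zeroʳ S)
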